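{- For every (possibly partial) Boolean function $f$ on $n$ bits with $\mathsf s(f)\neq0$, $$\mathsf{CG}^{\mathrm{pub}}_{[1]}(f)=\Theta(\mathsf s(f)),$$ where the constants hidden in $\Theta(\cdot)$ are absolute (independent of $f$ and $n$).
   Context: A (possibly partial) Boolean function on $n$ bits is $f:\{0,1\}^n\to\{0,1,*\}$, where $*$ means undefined. $[n]=\{1,\dots,n\}$; $d$ is Hamming distance; $x^{(i)}$ is $x$ with the $i$th bit flipped. Sensitivity: for $x\in f^{ -1}(0)\cup f^{ -1}(1)$, $\mathsf s(f;x)$ is the number of $i\in[n]$ such that $f$ is defined at $x^{(i)}$ and $f(x^{(i)})=1-f(x)$; $\mathsf s(f)=\max_x\mathsf s(f;x)$. Single-bit public coin certificate game complexity: a deterministic strategy is a pair $(A,B)$ with $A:f^{ -1}(0)\to[n]$, $B:f^{ -1}(1)\to[n]$; it is correct on $(x,y)$ if $A(x)=B(y)=i$ with $x_i\neq y_i$. Then $$\mathsf{CG}^{\mathrm{pub}}_{[1]}(f)=\min_p\ \max_{\substack{x\in f^{ -1}(0),\,y\in f^{ -1}(1)\\ d(x,y)=1}}\Big(\sum_{(A,B)\text{ correct on }(x,y)}p_{A,B}\Big)^{ -1},$$ where $p$ ranges over probability distributions on pairs $(A,B)$ of deterministic strategies, and $1/0=+\infty$. -}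

module Defs where

open import Algebra.Bundles using (CommutativeRing)
open import Algebra.Structures using (IsCommutativeRing)
open import Data.Bool.Base using (Bool; true; false; not; _xor_)
open import Data.Bool.Properties using () renaming (_≟_ to _≟ᵇ_)
open import Data.Fin.Base using (Fin)
open import Data.Fin.Properties using () renaming (_≟_ to _≟ᶠ_)
open import Data.List.Base
  using (List; []; _∷_; _++_; map; mapMaybe; filter; foldr; length; allFin; cartesianProduct)
import Data.List.Extrema
open import Data.List.Extrema.Nat using () renaming (max to maxℕ)
open import Data.List.Relation.Unary.All using (All)
open import Data.Maybe.Base as Maybe using (Maybe; just; nothing)
open import Data.Maybe.Properties using () renaming (≡-dec to ≡-decᵐ)
open import Data.Nat.Base using (ℕ; zero; suc)
open import Data.Nat.Properties using () renaming (_≟_ to _≟ⁿ_)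
open import Data.Product.Base using (_×_; _,_; ∃; proj₁; proj₂)
open import Data.Vec.Base using (Vec; lookup; updateAt; zipWith; count) renaming ([] to []ᵛ; _∷_ to _∷ᵛ_)
open import Level using (Level; _⊔_) renaming (suc to lsuc)
open import Relation.Binary.Bundles using (TotalOrder)
open import Relation.Binary.Core using (Rel)
import Relation.Binary.Construct.Add.Supremum.NonStrict as AddSupremum
import Relation.Binary.Construct.NonStrictToStrict as NonStrictToStrict
open import Relation.Binary.Definitions using (DecidableEquality)
open import Relation.Binary.PropositionalEquality.Core using (_≡_; _≢_)
open import Relation.Binary.Structures using (IsDecTotalOrder)
open import Relation.Nullary.Construct.Add.Supremum using (_⁺; [_]; ⊤⁺)
open import Relation.Nullary.Decidable.Core using (Dec; yes; no; dec⇒maybe; ¬?; _×-dec_)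

------------------------------------------------------------------------
-- Ordered fields

-- The library has no real numbers, so probabilities take values in an
-- arbitrary (linearly) ordered field, of which ℝ and ℚ are instances.
-- The inverse is a total operation, unspecified at 0#.

record OrderedField (c ℓ : Level) : Set (lsuc (c ⊔ ℓ)) where
  infix  8 -_ _⁻¹
  infixl 7 _*_
  infixl 6 _+_
  infix  4 _≤_
  field
    Carrier           : Set c
    _≤_               : Rel Carrier ℓ
    _+_ _*_           : Carrier → Carrier → Carrier
    -_ _⁻¹            : Carrier → Carrier
    0# 1#             : Carrier
    isCommutativeRing : IsCommutativeRing _≡_ _+_ _*_ -_ 0# 1#
    0#≢1#             : 0# ≢ 1#
    ⁻¹-inverseʳ       : ∀ x → x ≢ 0# → x * x ⁻¹ ≡ 1#
    isDecTotalOrder   : IsDecTotalOrder _≡_ _≤_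
    +-monoˡ-≤         : ∀ z {x y} → x ≤ y → x + z ≤ y + z
    *-nonNegative     : ∀ {x y} → 0# ≤ x → 0# ≤ y → 0# ≤ x * y

  open IsDecTotalOrder isDecTotalOrder public
    using (_≟_; _≤?_)

  open NonStrictToStrict _≡_ _≤_ public using (_<_)

  commutativeRing : CommutativeRing c c
  commutativeRing = record { isCommutativeRing = isCommutativeRing }

  fromℕ : ℕ → Carrier
  fromℕ zero    = 0#
  fromℕ (suc n) = 1# + fromℕ n

  sum : List Carrier → Carrier
  sum = foldr _+_ 0#

  -- Carrier ⁺ adjoins +∞ (written ⊤⁺) as a greatest element.
  open AddSupremum _≤_ public using (_≤⁺_; ≤⁺-isDecTotalOrder-≡)

  totalOrder⁺ : TotalOrder c c (c ⊔ ℓ)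
  totalOrder⁺ = record
    { isTotalOrder = IsDecTotalOrder.isTotalOrder (≤⁺-isDecTotalOrder-≡ isDecTotalOrder) }

  open Data.List.Extrema totalOrder⁺ public using () renaming (max to max⁺)

  -- Reciprocal with 1/0 = +∞.
  1/⁺ : Carrier → Carrier ⁺
  1/⁺ x with x ≟ 0#
  ... | yes _ = ⊤⁺
  ... | no  _ = [ x ⁻¹ ]

------------------------------------------------------------------------
-- Partial Boolean functions; nothing means undefined

PartialBoolFn : ℕ → Set
PartialBoolFn n = Vec Bool n → Maybe Bool

allInputs : ∀ n → List (Vec Bool n)
allInputs zero    = []ᵛ ∷ []
allInputs (suc n) = map (false ∷ᵛ_) (allInputs n) ++ map (true ∷ᵛ_) (allInputs n)

flipBit : ∀ {n} → Vec Bool n → Fin n → Vec Bool n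
flipBit x i = updateAt x i not

hamming : ∀ {n} → Vec Bool n → Vec Bool n → ℕ
hamming x y = count (_≟ᵇ true) (zipWith _xor_ x y)

infix 4 _≟ᵐ_
_≟ᵐ_ : DecidableEquality (Maybe Bool)
_≟ᵐ_ = ≡-decᵐ _≟ᵇ_

-- Inputs outside the domain get sensitivity 0, so they do not affect the
-- maximum over the domain (which is taken to be 0 if the domain is empty).

sensitivityAt : ∀ {n} → PartialBoolFn n → Vec Bool n → ℕ
sensitivityAt {n} f x with f x
... | nothing = 0
... | just b  = length (filter (λ i → f (flipBit x i) ≟ᵐ just (not b)) (allFin n))

sensitivity : ∀ {n} → PartialBoolFn n → ℕ
sensitivity {n} f = maxℕ 0 (map (sensitivityAt f) (allInputs n))

Preimage : ∀ {n} → PartialBoolFn n → Bool → Set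
Preimage f b = ∃ λ x → f x ≡ just b

preimages : ∀ {n} (f : PartialBoolFn n) b → List (Preimage f b)
preimages {n} f b =
  mapMaybe (λ x → Maybe.map (x ,_) (dec⇒maybe (f x ≟ᵐ just b))) (allInputs n)

-- The pairs (x , y) with f x = 0, f y = 1 and d(x , y) = 1.

sensitivePairs : ∀ {n} (f : PartialBoolFn n) → List (Preimage f false × Preimage f true)
sensitivePairs f =
  filter (λ ((x , _) , (y , _)) → hamming x y ≟ⁿ 1)
         (cartesianProduct (preimages f false) (preimages f true))

------------------------------------------------------------------------
-- Certificate games

Strategy : ∀ {n} → PartialBoolFn n → Set
Strategy {n} f = (Preimage f false → Fin n) × (Preimage f true → Fin n)

Correct : ∀ {n} {f : PartialBoolFn n} →
          Preimage f false → Preimage f true → Strategy f → Set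
Correct x y (A , B) =
  A x ≡ B y × lookup (proj₁ x) (A x) ≢ lookup (proj₁ y) (A x)

correct? : ∀ {n} {f : PartialBoolFn n} x y (S : Strategy f) → Dec (Correct x y S)
correct? x y (A , B) =
  (A x ≟ᶠ B y) ×-dec ¬? (lookup (proj₁ x) (A x) ≟ᵇ lookup (proj₁ y) (A x))

module CertificateGame {c ℓ} (K : OrderedField c ℓ) where
  open OrderedField K

  -- A probability distribution on a finite set, as a list of weighted
  -- points: the probability of s is the total weight of the entries (p , s).

  record Distribution (S : Set) : Set (c ⊔ ℓ) where
    field
      entries     : List (Carrier × S)
      nonNegative : All (λ (p , _) → 0# ≤ p) entries
      total       : sum (map proj₁ entries) ≡ 1#

  module _ {n} {f : PartialBoolFn n} (p : Distribution (Strategy f)) where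
    open Distribution p

    successProbability : Preimage f false → Preimage f true → Carrier
    successProbability x y =
      sum (map proj₁ (filter (λ (_ , S) → correct? x y S) entries))

    -- The base value 0 only matters when there are no sensitive pairs,
    -- i.e. when the sensitivity is 0; all reciprocals here are positive.

    cost : Carrier ⁺
    cost = max⁺ [ 0# ] (map (λ (x , y) → 1/⁺ (successProbability x y)) (sensitivePairs f))

  -- v is the single-bit public coin certificate game complexity of f,
  -- i.e. the minimum of the cost over all distributions on strategies.

  IsCGpub₁ : ∀ {n} → PartialBoolFn n → Carrier ⁺ → Set (c ⊔ ℓ)
  IsCGpub₁ f v =
    (∃ λ (p : Distribution (Strategy f)) → cost p ≡ v) ×
    (∀ (p : Distribution (Strategy f)) → v ≤⁺ cost p)

{-# OPTIONS --safe #-}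
module Submission where

-- For adjacent x, y the two players can only be correct with the coordinate in which x and y
-- differ, so the pairs won by a deterministic strategy form a matching of the bipartite graph of
-- sensitive pairs, whose maximum degree is s(f).  At an input of maximal sensitivity the s(f)
-- winning events are disjoint, so one of them has probability at most 1/s(f).  Conversely, by
-- König's edge-colouring theorem the sensitive pairs split into s(f) matchings; playing a
-- uniformly random one wins every pair with probability at least 1/s(f).  Hence the minimum is
-- attained and equals s(f), and both constants are 1.

open import Defs
open import Algebra.Bundles using (CommutativeRing)
import Algebra.Properties.Ring as RingProperties
open import Axiom.UniquenessOfIdentityProofs using (module Decidable⇒UIP)
open import Data.Bool.Base using (Bool; true; false; not)
open import Data.Bool.Properties using (not-involutive; not-¬) renaming (_≟_ to _≟ᵇ_)
open import Data.Fin.Base using (Fin; zero; suc)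
open import Data.Fin.Properties using () renaming (_≟_ to _≟ᶠ_)
open import Data.List.Base
  using (List; []; _∷_; _++_; map; concat; filter; length; allFin; cartesianProduct)
import Data.List.Extrema
open import Data.List.Extrema.Nat using (argmax-sel; xs≤max)
open import Data.List.Membership.Propositional using (_∈_; _∉_; find; lose)
open import Data.List.Membership.Propositional.Properties
  using ( ∈-++⁺ˡ; ∈-++⁺ʳ; ∈-++⁻; ∈-∃++; ∈-map⁺; ∈-map⁻; ∈-filter⁺; ∈-filter⁻; ∈-concat⁻′
        ; ∈-allFin; ∈-cartesianProduct⁺)
open import Data.List.Properties using (filter-++; length-++; ++-assoc; length-map; map-∘)
open import Data.List.Relation.Binary.Permutation.Propositional
  using (_↭_; prep; swap; ↭-refl; ↭-sym; ↭-trans; ↭-reflexive; ↭⇒↭ₛ)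
open import Data.List.Relation.Binary.Permutation.Propositional.Properties
  using (All-resp-↭; Any-resp-↭; ∈-resp-↭; shift; ↭-length; filter-↭)
  renaming ( map⁺ to map-↭; ++-comm to ↭-++-comm; ++⁺ˡ to ↭-++⁺ˡ; ++⁺ʳ to ↭-++⁺ʳ; ++⁺ to ↭-++⁺)
import Data.List.Relation.Binary.Permutation.Setoid.Properties as PermutationSetoid
open import Data.List.Relation.Binary.Subset.Propositional using (_⊆_)
open import Data.List.Relation.Unary.All as All using (All; []; _∷_)
import Data.List.Relation.Unary.All.Properties as All
open import Data.List.Relation.Unary.AllPairs using ([]; _∷_)
open import Data.List.Relation.Unary.Any as Any using (Any; here; there)
import Data.List.Relation.Unary.Any.Properties as Any
open import Data.List.Relation.Unary.Unique.Propositional using (Unique)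
open import Data.List.Relation.Unary.Unique.Propositional.Properties
  using (Unique[x∷xs]⇒x∉xs; cartesianProduct⁺; allFin⁺; filter⁺)
  renaming (map⁺ to Unique-map⁺; ++⁺ to Unique-++⁺)
open import Data.Maybe.Base as Maybe using (Maybe; just; nothing)
import Data.Maybe.Relation.Unary.Any as MaybeAny
open import Data.Nat.Base as ℕ using (ℕ; zero; suc; z≤n; s≤s)
import Data.Nat.Properties as ℕ
open import Data.Product.Base using (_×_; _,_; ∃; ∃₂; proj₁; proj₂)
open import Data.Sum.Base using (inj₁; inj₂)
open import Data.Vec.Base using (Vec; lookup) renaming ([] to []ᵛ; _∷_ to _∷ᵛ_)
open import Data.Vec.Properties
  using ( updateAt-updateAt; updateAt-id-local; lookup∘updateAt; lookup∘updateAt′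
        ; ≡-dec; ∷-injectiveʳ)
open import Function.Base using (_∘_; id)
open import Relation.Binary.Bundles using (TotalOrder)
import Relation.Binary.Construct.Add.Supremum.NonStrict as AddSupremum
open import Relation.Binary.Definitions using (DecidableEquality)
open import Relation.Binary.PropositionalEquality
open import Relation.Binary.Structures using (IsDecTotalOrder)
open import Relation.Nullary.Construct.Add.Supremum using (_⁺; [_])
open import Relation.Nullary.Decidable.Core using (yes; no; dec⇒maybe; _×-dec_)
open import Relation.Nullary.Negation.Core using (contradiction)
open import Relation.Unary using (Pred; Decidable)

open Decidable⇒UIP _≟ᵐ_ using (≡-irrelevant)

-- Lists up to permutation and lists without repetition.

module _ {a} {A : Set a} where

  ∈⇒∷↭ : ∀ {x : A} {xs} → x ∈ xs → ∃ λ ys → xs ↭ x ∷ ys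
  ∈⇒∷↭ {x} x∈xs with ys , zs , refl ← ∈-∃++ x∈xs = ys ++ zs , shift x ys zs

  Unique-resp-↭ : ∀ {xs ys : List A} → xs ↭ ys → Unique xs → Unique ys
  Unique-resp-↭ p = PermutationSetoid.Unique-resp-↭ (setoid A) (↭⇒↭ₛ p)

  concat-↭ : ∀ {xss yss : List (List A)} → xss ↭ yss → concat xss ↭ concat yss
  concat-↭ _↭_.refl = ↭-refl
  concat-↭ (prep xs p) = ↭-++⁺ˡ xs (concat-↭ p)
  concat-↭ (swap {xss} {yss} xs ys p) =
    ↭-trans (↭-reflexive (sym (++-assoc xs ys (concat xss))))
    (↭-trans (↭-++⁺ (↭-++-comm xs ys) (concat-↭ p)) (↭-reflexive (++-assoc ys xs (concat yss))))
  concat-↭ (_↭_.trans p q) = ↭-trans (concat-↭ p) (concat-↭ q)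

  unique-∷ : ∀ {x : A} {xs} → x ∉ xs → Unique xs → Unique (x ∷ xs)
  unique-∷ x∉xs u = All.¬Any⇒All¬ _ x∉xs ∷ u

  unique-tail : ∀ {x : A} {xs} → Unique (x ∷ xs) → Unique xs
  unique-tail (_ ∷ u) = u

  ∉-∷ : ∀ {x y : A} {xs} → x ≢ y → x ∉ xs → x ∉ y ∷ xs
  ∉-∷ x≢y x∉xs (here x≡y)   = x≢y x≡y
  ∉-∷ x≢y x∉xs (there x∈xs) = x∉xs x∈xs

-- König's edge-colouring theorem

module _ {a b} {A : Set a} {B : Set b} (_≟_ : DecidableEquality B) (k : A → B) where

  degree : B → List A → ℕ
  degree y = length ∘ filter (λ x → k x ≟ y)

  degree-↭ : ∀ {xs ys} y → xs ↭ ys → degree y xs ≡ degree y ys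
  degree-↭ y p = ↭-length (filter-↭ (λ x → k x ≟ y) p)

  degree-++ : ∀ y xs ys → degree y (xs ++ ys) ≡ degree y xs ℕ.+ degree y ys
  degree-++ y xs ys =
    trans (cong length (filter-++ (λ x → k x ≟ y) xs ys)) (length-++ (filter (λ x → k x ≟ y) xs))

  degree-∷-≡ : ∀ x xs → degree (k x) (x ∷ xs) ≡ suc (degree (k x) xs)
  degree-∷-≡ x xs with k x ≟ k x
  ... | yes _ = refl
  ... | no ≢ = contradiction refl ≢

  degree-∷-≥ : ∀ y x xs → degree y xs ℕ.≤ degree y (x ∷ xs)
  degree-∷-≥ y x xs with k x ≟ y
  ... | yes _ = ℕ.n≤1+n _
  ... | no _  = ℕ.≤-reflexive refl

  degree-positive : ∀ {y xs} → y ∈ map k xs → 1 ℕ.≤ degree y xs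
  degree-positive {xs = x ∷ xs} (here refl) rewrite degree-∷-≡ x xs = s≤s z≤n
  degree-positive {xs = x ∷ xs} (there y∈) = ℕ.≤-trans (degree-positive y∈) (degree-∷-≥ _ x xs)

  -- Pigeonhole: every class that meets `y` contributes at least 1 to the degree, so a degree below
  -- the number of classes leaves one that misses `y`.
  classMissing : ∀ y xss → degree y (concat xss) ℕ.< length xss → Any (λ xs → y ∉ map k xs) xss
  classMissing y (xs ∷ xss) d< with Any.any? (y ≟_) (map k xs)
  ... | no y∉  = here y∉
  ... | yes y∈ = there (classMissing y xss (ℕ.≤-pred (ℕ.≤-trans (s≤s step) d<)))
    where
    step : suc (degree y (concat xss)) ℕ.≤ degree y (xs ++ concat xss)
    step rewrite degree-++ y xs (concat xss) = ℕ.+-mono-≤ (degree-positive y∈) (ℕ.≤-reflexive refl)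

-- The two sides are told apart by the maps `left` and `right`, so bipartiteness is built in even
-- when `X` and `Y` coincide. Parallel edges are allowed.
module EdgeColouring {a b c} {E : Set a} {X : Set b} {Y : Set c}
  (_≟ˣ_ : DecidableEquality X) (_≟ʸ_ : DecidableEquality Y)
  (left : E → X) (right : E → Y) where

  Matching : List E → Set _
  Matching es = Unique (map left es) × Unique (map right es)

  Matching-resp-↭ : ∀ {es fs} → es ↭ fs → Matching es → Matching fs
  Matching-resp-↭ p (ul , ur) = Unique-resp-↭ (map-↭ left p) ul , Unique-resp-↭ (map-↭ right p) ur

  matching-∷ : ∀ {e es} → left e ∉ map left es → right e ∉ map right es →
               Matching es → Matching (e ∷ es)
  matching-∷ l∉ r∉ (ul , ur) = unique-∷ l∉ ul , unique-∷ r∉ ur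

  -- The alternating path starting with e is swapped: its edges from P go to Q′ and
  -- those from Q go to P′. The left ends of P′ stay inside those of P, so the path
  -- cannot return to left e; this is where bipartiteness is used.
  exchange : ∀ m P Q e → length P ℕ.< m → Matching P → Matching Q →
             left e ∉ map left P → right e ∉ map right Q →
             ∃₂ λ P′ Q′ → P′ ++ Q′ ↭ P ++ Q × Matching (e ∷ P′) × Matching Q′ ×
                          map left P′ ⊆ map left P
  exchange (suc m) P Q e |P|<1+m MP MQ l∉P r∉Q with Any.any? (right e ≟ʸ_) (map right P)
  ... | no r∉P = P , Q , ↭-refl , matching-∷ l∉P r∉P MP , MQ , id
  ... | yes r∈P with e₁ , e₁∈P , re≡ ← ∈-map⁻ right r∈P with P₁ , P↭ ← ∈⇒∷↭ e₁∈P
    with Any.any? (left e₁ ≟ˣ_) (map left Q)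
  ... | no l₁∉Q =
    P₁ , e₁ ∷ Q ,
    ↭-trans (shift e₁ P₁ Q) (↭-++⁺ʳ Q (↭-sym P↭)) ,
    matching-∷ (λ l∈ → l∉P (P₁⊆P l∈))
               (λ r∈ → Unique[x∷xs]⇒x∉xs (proj₂ MP₁) (subst (_∈ map right P₁) re≡ r∈))
               (unique-tail (proj₁ MP₁) , unique-tail (proj₂ MP₁)) ,
    matching-∷ l₁∉Q (subst (_∉ map right Q) re≡ r∉Q) MQ ,
    P₁⊆P
    where
    MP₁ : Matching (e₁ ∷ P₁)
    MP₁ = Matching-resp-↭ P↭ MP
    P₁⊆P : map left P₁ ⊆ map left P
    P₁⊆P l∈ = ∈-resp-↭ (map-↭ left (↭-sym P↭)) (there l∈)
  ... | yes l₁∈Q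
    with e₂ , e₂∈Q , le₁≡ ← ∈-map⁻ left l₁∈Q with Q₁ , Q↭ ← ∈⇒∷↭ e₂∈Q
    -- Now `e₂` seeks a place in `P₁` as `e` did in `P`. The first matching loses an edge each
    -- round, so `m` bounds the number of rounds.
    = conclude (exchange m P₁ Q₁ e₂ |P₁|<m
        (unique-tail (proj₁ MP₁) , unique-tail (proj₂ MP₁))
        (unique-tail (proj₁ MQ₁) , unique-tail (proj₂ MQ₁))
        (subst (_∉ map left P₁) le₁≡ l₁∉P₁) r₂∉Q₁)
    where
    MP₁ : Matching (e₁ ∷ P₁)
    MP₁ = Matching-resp-↭ P↭ MP
    MQ₁ : Matching (e₂ ∷ Q₁)
    MQ₁ = Matching-resp-↭ Q↭ MQ
    |P₁|<m : length P₁ ℕ.< m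
    |P₁|<m = ℕ.≤-trans (ℕ.≤-reflexive (sym (↭-length P↭))) (ℕ.≤-pred |P|<1+m)
    P₁⊆P : map left (e₁ ∷ P₁) ⊆ map left P
    P₁⊆P = ∈-resp-↭ (map-↭ left (↭-sym P↭))
    Q₁⊆Q : map right (e₂ ∷ Q₁) ⊆ map right Q
    Q₁⊆Q = ∈-resp-↭ (map-↭ right (↭-sym Q↭))
    l₁∉P₁ : left e₁ ∉ map left P₁
    l₁∉P₁ = Unique[x∷xs]⇒x∉xs (proj₁ MP₁)
    l₁∉Q₁ : left e₁ ∉ map left Q₁
    l₁∉Q₁ = subst (_∉ map left Q₁) (sym le₁≡) (Unique[x∷xs]⇒x∉xs (proj₁ MQ₁))
    r₂∉Q₁ : right e₂ ∉ map right Q₁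
    r₂∉Q₁ = Unique[x∷xs]⇒x∉xs (proj₂ MQ₁)
    r∉P₁ : right e ∉ map right P₁
    r∉P₁ = subst (_∉ map right P₁) (sym re≡) (Unique[x∷xs]⇒x∉xs (proj₂ MP₁))

    conclude : (∃₂ λ P′ Q′ → P′ ++ Q′ ↭ P₁ ++ Q₁ × Matching (e₂ ∷ P′) × Matching Q′ ×
                             map left P′ ⊆ map left P₁) →
               ∃₂ λ P′ Q′ → P′ ++ Q′ ↭ P ++ Q × Matching (e ∷ P′) × Matching Q′ ×
                            map left P′ ⊆ map left P
    conclude (P′ , Q′ , ↭₁ , MP′ , MQ′ , P′⊆) =
      e₂ ∷ P′ , e₁ ∷ Q′ ,
      ↭-trans (prep e₂ (↭-trans (shift e₁ P′ Q′) (prep e₁ ↭₁)))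
        (↭-trans (↭-sym (shift e₂ (e₁ ∷ P₁) Q₁)) (↭-++⁺ (↭-sym P↭) (↭-sym Q↭))) ,
      -- `left e` may occur in `Q`, so only the invariant on left ends keeps it out of `P′`. The
      -- ends `right e`, `left e₁` and `right e₁` are absent from both `P₁` and `Q₁`, which supply
      -- all edges of `P′` and `Q′`.
      matching-∷ (l∉P ∘ e₂P′⊆) (∉-∷ (λ eq → r∉Q (Q₁⊆Q (here eq)))
                                    (avoid right P′⊆all r∉P₁ (r∉Q ∘ Q₁⊆Q ∘ there))) MP′ ,
      matching-∷ (avoid left Q′⊆all l₁∉P₁ l₁∉Q₁)
                 (avoid right Q′⊆all (Unique[x∷xs]⇒x∉xs (proj₂ MP₁))
                    (λ r∈ → r∉Q (Q₁⊆Q (there (subst (_∈ map right Q₁) (sym re≡) r∈))))) MQ′ ,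
      e₂P′⊆
      where
      e₂P′⊆ : map left (e₂ ∷ P′) ⊆ map left P
      e₂P′⊆ (here refl) = subst (_∈ map left P) le₁≡ (P₁⊆P (here refl))
      e₂P′⊆ (there l∈)  = P₁⊆P (there (P′⊆ l∈))
      P′⊆all : P′ ⊆ P₁ ++ Q₁
      P′⊆all = ∈-resp-↭ ↭₁ ∘ ∈-++⁺ˡ
      Q′⊆all : Q′ ⊆ P₁ ++ Q₁
      Q′⊆all = ∈-resp-↭ ↭₁ ∘ ∈-++⁺ʳ P′
      avoid : ∀ {d} {Z : Set d} (k : E → Z) {z R} → R ⊆ P₁ ++ Q₁ →
              z ∉ map k P₁ → z ∉ map k Q₁ → z ∉ map k R
      avoid k R⊆ z∉P₁ z∉Q₁ z∈R with g , g∈R , refl ← ∈-map⁻ k z∈R with ∈-++⁻ P₁ (R⊆ g∈R)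
      ... | inj₁ g∈P₁ = z∉P₁ (∈-map⁺ k g∈P₁)
      ... | inj₂ g∈Q₁ = z∉Q₁ (∈-map⁺ k g∈Q₁)

  -- Exactly `Δ` classes, some possibly empty: a uniformly random class then has weight `1/Δ`.
  Colouring : ℕ → List E → Set _
  Colouring Δ es = ∃ λ Ms → length Ms ≡ Δ × All Matching Ms × concat Ms ↭ es

  -- Fewer than `Δ` edges at each end leave one class free at `left e` and one free at `right e`. If
  -- the two classes found coincide, `e` joins that class; otherwise `exchange` recombines them so
  -- that one is free at both ends.
  insert : ∀ {Δ es} e → degree _≟ˣ_ left (left e) es ℕ.< Δ → degree _≟ʸ_ right (right e) es ℕ.< Δ →
           Colouring Δ es → Colouring Δ (e ∷ es)
  insert {es = es} e l< r< (Ms , refl , MMs , ↭es)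
    with M , M∈ , l∉M ← find (classMissing _≟ˣ_ left (left e) Ms
           (subst (ℕ._< length Ms) (sym (degree-↭ _≟ˣ_ left (left e) ↭es)) l<))
    with Ns , Ms↭ ← ∈⇒∷↭ M∈
    with All-resp-↭ Ms↭ MMs | Any-resp-↭ Ms↭ (classMissing _≟ʸ_ right (right e) Ms
           (subst (ℕ._< length Ms) (sym (degree-↭ _≟ʸ_ right (right e) ↭es)) r<))
  ... | MM ∷ MNs | here r∉M =
    (e ∷ M) ∷ Ns , sym (↭-length Ms↭) , matching-∷ l∉M r∉M MM ∷ MNs ,
    prep e (↭-trans (concat-↭ (↭-sym Ms↭)) ↭es)
  ... | MM ∷ MNs | there r∉
    with N , N∈ , r∉N ← find r∉ with Os , Ns↭ ← ∈⇒∷↭ N∈ with MN ∷ MOs ← All-resp-↭ Ns↭ MNs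
    with M′ , N′ , ↭₁ , MM′ , MN′ , _ ←
           exchange (suc (length M)) M N e (ℕ.≤-reflexive refl) MM MN l∉M r∉N =
    (e ∷ M′) ∷ N′ ∷ Os ,
    sym (↭-length Ms↭′) ,
    MM′ ∷ MN′ ∷ MOs ,
    prep e (↭-trans (↭-reflexive (sym (++-assoc M′ N′ _)))
           (↭-trans (↭-++⁺ʳ (concat Os) ↭₁)
           (↭-trans (↭-reflexive (++-assoc M N _))
           (↭-trans (concat-↭ (↭-sym Ms↭′)) ↭es))))
    where
    Ms↭′ : Ms ↭ M ∷ N ∷ Os
    Ms↭′ = ↭-trans Ms↭ (prep M Ns↭)

  empty : ∀ Δ → Colouring Δ []
  empty zero    = [] , refl , [] , ↭-refl
  empty (suc Δ) with Ms , len , MMs , p ← empty Δ = [] ∷ Ms , cong suc len , ([] , []) ∷ MMs , p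

  -- Edges are inserted one at a time. The edge `e` counts towards the degrees of its own ends, so
  -- in `es` these degrees are strictly below `Δ`.
  könig : ∀ {Δ} es → (∀ x → degree _≟ˣ_ left x es ℕ.≤ Δ) → (∀ y → degree _≟ʸ_ right y es ℕ.≤ Δ) →
          Colouring Δ es
  könig []       _  _  = empty _
  könig (e ∷ es) dl dr =
    insert e (subst (ℕ._≤ _) (degree-∷-≡ _≟ˣ_ left e es) (dl (left e)))
             (subst (ℕ._≤ _) (degree-∷-≡ _≟ʸ_ right e es) (dr (right e)))
      (könig es (λ x → ℕ.≤-trans (degree-∷-≥ _≟ˣ_ left x e es) (dl x))
                (λ y → ℕ.≤-trans (degree-∷-≥ _≟ʸ_ right y e es) (dr y)))

-- The graph of sensitive pairs

-- The elements of `xs` are deleted from `ys` in turn; since they are distinct, the later ones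
-- survive each deletion.
⊆⇒length≤ : ∀ {a} {A : Set a} {xs ys : List A} → Unique xs → xs ⊆ ys → length xs ℕ.≤ length ys
⊆⇒length≤ {xs = []} _ _ = z≤n
⊆⇒length≤ {xs = x ∷ xs} {ys} u@(_ ∷ uxs) sub with zs , p ← ∈⇒∷↭ (sub (here refl)) =
  ℕ.≤-trans (s≤s (⊆⇒length≤ uxs sub′)) (ℕ.≤-reflexive (sym (↭-length p)))
  where
  sub′ : xs ⊆ zs
  sub′ y∈xs with ∈-resp-↭ p (sub (there y∈xs))
  ... | here refl  = contradiction y∈xs (Unique[x∷xs]⇒x∉xs u)
  ... | there y∈zs = y∈zs

-- Bit flips and Hamming distance.

_≟ᵛ_ : ∀ {n} → DecidableEquality (Vec Bool n)
_≟ᵛ_ = ≡-dec _≟ᵇ_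

flipBit-involutive : ∀ {n} (x : Vec Bool n) i → flipBit (flipBit x i) i ≡ x
flipBit-involutive x i =
  trans (updateAt-updateAt i x) (updateAt-id-local i x (not-involutive (lookup x i)))

lookup-flipBit-≢ : ∀ {n} (x : Vec Bool n) i → lookup x i ≢ lookup (flipBit x i) i
lookup-flipBit-≢ x i eq = not-¬ refl (trans eq (lookup∘updateAt i x))

flipBit-differs : ∀ {n} (x : Vec Bool n) i j → lookup x j ≢ lookup (flipBit x i) j → j ≡ i
flipBit-differs x i j ≢ with j ≟ᶠ i
... | yes j≡i = j≡i
... | no j≢i  = contradiction (sym (lookup∘updateAt′ j i j≢i x)) ≢

hamming-self : ∀ {n} (x : Vec Bool n) → hamming x x ≡ 0
hamming-self []ᵛ          = refl
hamming-self (true ∷ᵛ x)  = hamming-self x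
hamming-self (false ∷ᵛ x) = hamming-self x

hamming-flipBit : ∀ {n} (x : Vec Bool n) i → hamming x (flipBit x i) ≡ 1
hamming-flipBit (true ∷ᵛ x)  zero    = cong suc (hamming-self x)
hamming-flipBit (false ∷ᵛ x) zero    = cong suc (hamming-self x)
hamming-flipBit (true ∷ᵛ x)  (suc i) = hamming-flipBit x i
hamming-flipBit (false ∷ᵛ x) (suc i) = hamming-flipBit x i

hamming≡0⇒≡ : ∀ {n} (x y : Vec Bool n) → hamming x y ≡ 0 → y ≡ x
hamming≡0⇒≡ []ᵛ []ᵛ _ = refl
hamming≡0⇒≡ (true ∷ᵛ x) (true ∷ᵛ y) eq = cong (true ∷ᵛ_) (hamming≡0⇒≡ x y eq)
hamming≡0⇒≡ (false ∷ᵛ x) (false ∷ᵛ y) eq = cong (false ∷ᵛ_) (hamming≡0⇒≡ x y eq)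

hamming≡1⇒flipBit : ∀ {n} (x y : Vec Bool n) → hamming x y ≡ 1 → ∃ λ i → y ≡ flipBit x i
hamming≡1⇒flipBit []ᵛ []ᵛ ()
hamming≡1⇒flipBit (true ∷ᵛ x) (false ∷ᵛ y) eq =
  zero , cong (false ∷ᵛ_) (hamming≡0⇒≡ x y (ℕ.suc-injective eq))
hamming≡1⇒flipBit (false ∷ᵛ x) (true ∷ᵛ y) eq =
  zero , cong (true ∷ᵛ_) (hamming≡0⇒≡ x y (ℕ.suc-injective eq))
hamming≡1⇒flipBit (true ∷ᵛ x) (true ∷ᵛ y) eq with i , refl ← hamming≡1⇒flipBit x y eq = suc i , refl
hamming≡1⇒flipBit (false ∷ᵛ x) (false ∷ᵛ y) eq with i , refl ← hamming≡1⇒flipBit x y eq = suc i , refl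

∈-allInputs : ∀ {n} (x : Vec Bool n) → x ∈ allInputs n
∈-allInputs []ᵛ          = here refl
∈-allInputs (false ∷ᵛ x) = ∈-++⁺ˡ (∈-map⁺ (false ∷ᵛ_) (∈-allInputs x))
∈-allInputs (true ∷ᵛ x)  = ∈-++⁺ʳ _ (∈-map⁺ (true ∷ᵛ_) (∈-allInputs x))

allInputs-unique : ∀ n → Unique (allInputs n)
allInputs-unique zero    = [] ∷ []
allInputs-unique (suc n) =
  Unique-++⁺ (Unique-map⁺ ∷-injectiveʳ (allInputs-unique n)) (Unique-map⁺ ∷-injectiveʳ (allInputs-unique n))
      disjoint
  where
  disjoint : ∀ {x} → x ∈ map (false ∷ᵛ_) (allInputs n) × x ∈ map (true ∷ᵛ_) (allInputs n) → _
  disjoint (p , q) with _ , _ , refl ← ∈-map⁻ (false ∷ᵛ_) p | _ , _ , () ← ∈-map⁻ (true ∷ᵛ_) q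

-- Sensitive edges, their degrees and their colouring.

module _ {n} (f : PartialBoolFn n) where

  sensitiveBits : Vec Bool n → Bool → List (Fin n)
  sensitiveBits x b = filter (λ i → f (flipBit x i) ≟ᵐ just (not b)) (allFin n)

  sensitivityAt-defined : ∀ {x b} → f x ≡ just b → sensitivityAt f x ≡ length (sensitiveBits x b)
  sensitivityAt-defined {x} eq with f x | eq
  ... | just b | refl = refl

  sensitivityAt-undefined : ∀ {x} → f x ≡ nothing → sensitivityAt f x ≡ 0
  sensitivityAt-undefined {x} eq with f x | eq
  ... | nothing | refl = refl

  sensitivityAt≤sensitivity : ∀ x → sensitivityAt f x ℕ.≤ sensitivity f
  sensitivityAt≤sensitivity x =
    All.lookup (xs≤max 0 (map (sensitivityAt f) (allInputs n))) (∈-map⁺ _ (∈-allInputs x))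

  -- A nonzero maximum is neither the default value 0 nor the value at an undefined input, so it is
  -- attained inside the domain.
  mostSensitiveInput : sensitivity f ≢ 0 →
    ∃₂ λ x b → f x ≡ just b × length (sensitiveBits x b) ≡ sensitivity f
  mostSensitiveInput s≢0 with argmax-sel id 0 (map (sensitivityAt f) (allInputs n))
  ... | inj₁ s≡0 = contradiction s≡0 s≢0
  ... | inj₂ s∈  with x , _ , s≡ ← ∈-map⁻ (sensitivityAt f) s∈ = value (f x) refl
    where
    value : ∀ v → f x ≡ v → ∃₂ λ x b → f x ≡ just b × length (sensitiveBits x b) ≡ sensitivity f
    value (just b) fx≡ = x , b , fx≡ , trans (sym (sensitivityAt-defined fx≡)) (sym s≡)
    value nothing  fx≡ = contradiction (trans s≡ (sensitivityAt-undefined fx≡)) s≢0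

  ∈-preimages : ∀ {b} (x : Preimage f b) → x ∈ preimages f b
  ∈-preimages {b} (x , fx≡) =
    Any.mapMaybe⁺ tag (allInputs n)
      (Any.map⁺ (lose {P = MaybeAny.Any ((x , fx≡) ≡_) ∘ tag} (∈-allInputs x) hit))
    where
    tag : Vec Bool n → Maybe (Preimage f b)
    tag z = Maybe.map (z ,_) (dec⇒maybe (f z ≟ᵐ just b))
    hit : MaybeAny.Any ((x , fx≡) ≡_) (tag x)
    hit with f x ≟ᵐ just b
    -- The list stores the proof produced by the decision procedure; uniqueness of identity proofs
    -- identifies it with `fx≡`.
    ... | yes p  = MaybeAny.just (cong (x ,_) (≡-irrelevant fx≡ p))
    ... | no fx≢ = contradiction fx≡ fx≢

  ∈-sensitivePairs : ∀ {x y} → hamming (proj₁ x) (proj₁ y) ≡ 1 → (x , y) ∈ sensitivePairs f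
  ∈-sensitivePairs {x} {y} h =
    ∈-filter⁺ _ (∈-cartesianProduct⁺ (∈-preimages x) (∈-preimages y)) h

  -- An edge stands for a sensitive pair, given by its 0-input and the flipped coordinate, which is
  -- the answer both players have to name.
  Edge : Set
  Edge = Vec Bool n × Fin n

  right : Edge → Vec Bool n
  right (x , i) = flipBit x i

  sensitive? : (e : Edge) → _
  sensitive? e = (f (proj₁ e) ≟ᵐ just false) ×-dec (f (right e) ≟ᵐ just true)

  edges : List Edge
  edges = filter sensitive? (cartesianProduct (allInputs n) (allFin n))

  -- Treats both sides at once: `k` picks an end, `b` is the value of `f` there, and `g` rebuilds an
  -- edge from that end and its coordinate. Hence the edges at `x` inject into the sensitive bits of
  -- `x`.
  degree≤sensitivity : ∀ (k : Edge → Vec Bool n) b (g : Vec Bool n → Fin n → Edge) →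
    (∀ {e} → f (proj₁ e) ≡ just false × f (right e) ≡ just true →
             f (k e) ≡ just b × f (flipBit (k e) (proj₂ e)) ≡ just (not b) × e ≡ g (k e) (proj₂ e)) →
    ∀ x → degree _≟ᵛ_ k x edges ℕ.≤ sensitivity f
  degree≤sensitivity k b g sound x = ℕ.≤-trans bound (sensitivityAt≤sensitivity x)
    where
    unique : Unique (filter (λ e → k e ≟ᵛ x) edges)
    unique = filter⁺ _ (filter⁺ sensitive? (cartesianProduct⁺ (allInputs-unique n) (allFin⁺ n)))
    incident : ∀ {e} → e ∈ filter (λ e → k e ≟ᵛ x) edges →
               f x ≡ just b × f (flipBit x (proj₂ e)) ≡ just (not b) × e ≡ g x (proj₂ e)
    incident e∈ with e∈edges , refl ← ∈-filter⁻ (λ e → k e ≟ᵛ x) e∈ =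
      sound (proj₂ (∈-filter⁻ sensitive? {xs = cartesianProduct (allInputs n) (allFin n)} e∈edges))
    bound : degree _≟ᵛ_ k x edges ℕ.≤ sensitivityAt f x
    bound with f x ≟ᵐ just b
    -- An input whose value is not `b` meets no edge on this side.
    ... | no fx≢ = ℕ.≤-trans
      (⊆⇒length≤ {ys = []} unique (λ e∈ → contradiction (proj₁ (incident e∈)) fx≢)) z≤n
    ... | yes fx≡ = ℕ.≤-trans (⊆⇒length≤ unique sub)
      (ℕ.≤-reflexive (trans (length-map (g x) (sensitiveBits x b)) (sym (sensitivityAt-defined fx≡))))
      where
      sub : filter (λ e → k e ≟ᵛ x) edges ⊆ map (g x) (sensitiveBits x b)
      sub e∈ with _ , fy≡ , eq ← incident e∈ =
        subst (_∈ _) (sym eq) (∈-map⁺ (g x) (∈-filter⁺ _ (∈-allFin _) fy≡))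

  open EdgeColouring _≟ᵛ_ _≟ᵛ_ proj₁ right public

  abstract
    -- Left ends have value 0 and right ends value 1. From a right end the edge is rebuilt by
    -- flipping the bit back.
    edgeColouring : Colouring (sensitivity f) edges
    edgeColouring = könig edges
      (degree≤sensitivity proj₁ false _,_ (λ (fx , fy) → fx , fy , refl))
      (degree≤sensitivity right true (λ y i → flipBit y i , i)
        (λ { {x , i} (fx , fy) → fy , trans (cong f (flipBit-involutive x i)) fx ,
               cong (_, i) (sym (flipBit-involutive x i)) }))

  -- Colour classes and the strategies read off from them.

  colourClasses : List (List Edge)
  colourClasses = proj₁ edgeColouring

  length-colourClasses : length colourClasses ≡ sensitivity f
  length-colourClasses = proj₁ (proj₂ edgeColouring)

  edge∈colourClass : ∀ {x i} → f x ≡ just false → f (flipBit x i) ≡ just true →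
                     ∃ λ M → (x , i) ∈ M × M ∈ colourClasses × Matching M
  edge∈colourClass {x} {i} fx≡ fy≡
    with _ , _ , matchings , ↭edges ← edgeColouring
    with M , e∈M , M∈ ← ∈-concat⁻′ _ (∈-resp-↭ (↭-sym ↭edges)
           (∈-filter⁺ sensitive? (∈-cartesianProduct⁺ (∈-allInputs x) (∈-allFin i)) (fx≡ , fy≡)))
    = M , e∈M , M∈ , All.lookup matchings M∈

  -- The bit i₀ is a dummy move at inputs not covered by the matching.
  choose : Fin n → (Edge → Vec Bool n) → List Edge → Vec Bool n → Fin n
  choose i₀ k []       z = i₀
  choose i₀ k (e ∷ es) z with k e ≟ᵛ z
  ... | yes _ = proj₂ e
  ... | no _  = choose i₀ k es z

  -- The search stops at the first edge with the given end, and in a matching only one edge has it.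
  choose-∈ : ∀ i₀ k {es e} → Unique (map k es) → e ∈ es → choose i₀ k es (k e) ≡ proj₂ e
  choose-∈ i₀ k {e ∷ es} u (here refl) with k e ≟ᵛ k e
  ... | yes _ = refl
  ... | no ≢  = contradiction refl ≢
  choose-∈ i₀ k {e₀ ∷ es} {e} (∉ ∷ u) (there e∈) with k e₀ ≟ᵛ k e
  ... | yes eq = contradiction (subst (_∈ map k es) (sym eq) (∈-map⁺ k e∈)) (All.All¬⇒¬Any ∉)
  ... | no _   = choose-∈ i₀ k u e∈

  matchingStrategy : Fin n → List Edge → Strategy f
  matchingStrategy i₀ M = choose i₀ proj₁ M ∘ proj₁ , choose i₀ right M ∘ proj₁

  -- Each player finds the same edge of `M` from its own end, so both answer `i`.
  matchingStrategy-correct : ∀ i₀ {M x i} → Matching M → (x , i) ∈ M → ∀ fx fy →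
    Correct {f = f} (x , fx) (flipBit x i , fy) (matchingStrategy i₀ M)
  matchingStrategy-correct i₀ {M} {x} {i} (ul , ur) e∈M fx fy
    rewrite choose-∈ i₀ proj₁ ul e∈M | choose-∈ i₀ right ur e∈M =
    refl , lookup-flipBit-≢ x i

-- Probabilities in an ordered field

module OrderedFieldProperties {c ℓ} (K : OrderedField c ℓ) where
  open OrderedField K
  open IsDecTotalOrder isDecTotalOrder public
    using () renaming (refl to ≤-refl; reflexive to ≤-reflexive; trans to ≤-trans;
                       antisym to ≤-antisym; total to ≤-total)
  open CommutativeRing commutativeRing public
    using ( ring; +-assoc; +-comm; +-identityˡ; +-identityʳ; -‿inverseˡ; -‿inverseʳ
          ; *-assoc; *-comm; *-identityˡ; *-identityʳ; distribʳ; zeroˡ; zeroʳ)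
  open AddSupremum _≤_ using ([_]; _≤⊤⁺)
  open RingProperties ring using (-‿distribˡ-*; -‿distribʳ-*; -‿involutive)

  +-mono-≤ : ∀ {x y u v} → x ≤ y → u ≤ v → x + u ≤ y + v
  +-mono-≤ {x} {y} {u} {v} x≤y u≤v =
    ≤-trans (+-monoˡ-≤ u x≤y) (subst₂ _≤_ (+-comm u y) (+-comm v y) (+-monoˡ-≤ y u≤v))

  x≤y⇒0≤y-x : ∀ {x y} → x ≤ y → 0# ≤ y + - x
  x≤y⇒0≤y-x {x} {y} x≤y = subst (_≤ y + - x) (-‿inverseʳ x) (+-monoˡ-≤ (- x) x≤y)

  0≤y-x⇒x≤y : ∀ {x y} → 0# ≤ y + - x → x ≤ y
  0≤y-x⇒x≤y {x} {y} 0≤ = subst₂ _≤_ (+-identityˡ x)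
    (trans (+-assoc y (- x) x) (trans (cong (y +_) (-‿inverseˡ x)) (+-identityʳ y)))
    (+-monoˡ-≤ x 0≤)

  *-monoˡ-≤ : ∀ {x y z} → 0# ≤ z → x ≤ y → x * z ≤ y * z
  *-monoˡ-≤ {x} {y} {z} 0≤z x≤y = 0≤y-x⇒x≤y (subst (0# ≤_)
    (trans (distribʳ z y (- x)) (cong (y * z +_) (sym (-‿distribˡ-* x z))))
    (*-nonNegative (x≤y⇒0≤y-x x≤y) 0≤z))

  *-monoʳ-≤ : ∀ {x y z} → 0# ≤ z → x ≤ y → z * x ≤ z * y
  *-monoʳ-≤ {x} {y} {z} 0≤z x≤y = subst₂ _≤_ (*-comm x z) (*-comm y z) (*-monoˡ-≤ 0≤z x≤y)

  x≤0⇒0≤-x : ∀ {x} → x ≤ 0# → 0# ≤ - x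
  x≤0⇒0≤-x x≤0 = subst (0# ≤_) (+-identityˡ _) (x≤y⇒0≤y-x x≤0)

  0≤1 : 0# ≤ 1#
  0≤1 with ≤-total 0# 1#
  ... | inj₁ p = p
  -- Here `- 1#` is nonnegative, and `1#` is its square.
  ... | inj₂ 1≤0 = subst (0# ≤_)
    (trans (sym (-‿distribˡ-* 1# (- 1#))) (trans (cong -_ (*-identityˡ (- 1#))) (-‿involutive 1#)))
    (*-nonNegative (x≤0⇒0≤-x 1≤0) (x≤0⇒0≤-x 1≤0))

  1≰0 : ∀ {a} {A : Set a} → 1# ≤ 0# → A
  1≰0 1≤0 = contradiction (≤-antisym 0≤1 1≤0) 0#≢1#

  x≤x+y : ∀ {x y} → 0# ≤ y → x ≤ x + y
  x≤x+y {x} {y} 0≤y = subst (_≤ x + y) (+-identityʳ x) (+-mono-≤ ≤-refl 0≤y)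

  y≤x+y : ∀ {x y} → 0# ≤ x → y ≤ x + y
  y≤x+y {x} {y} 0≤x = subst (y ≤_) (+-comm y x) (x≤x+y 0≤x)

  ⁻¹-nonNegative : ∀ {x} → 0# ≤ x → x ≢ 0# → 0# ≤ x ⁻¹
  ⁻¹-nonNegative {x} 0≤x x≢0 with ≤-total 0# (x ⁻¹)
  ... | inj₁ p = p
  ... | inj₂ x⁻¹≤0 = 1≰0 (subst₂ _≤_ (⁻¹-inverseʳ x x≢0) (zeroʳ x) (*-monoʳ-≤ 0≤x x⁻¹≤0))

  0≤fromℕ : ∀ n → 0# ≤ fromℕ n
  0≤fromℕ zero    = ≤-refl
  0≤fromℕ (suc n) = ≤-trans (0≤fromℕ n) (y≤x+y 0≤1)

  -- Ordered fields have characteristic zero; this allows division by the sensitivity.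
  fromℕ≢0 : ∀ {n} → n ≢ 0 → fromℕ n ≢ 0#
  fromℕ≢0 {zero}  n≢0 _  = n≢0 refl
  fromℕ≢0 {suc n} _   eq = 1≰0 (subst (1# ≤_) eq (x≤x+y (0≤fromℕ n)))

  private
    *⁻¹-cancel : ∀ {d x} → x ≢ 0# → (d * x) * x ⁻¹ ≡ d
    *⁻¹-cancel {d} {x} x≢0 =
      trans (*-assoc d x (x ⁻¹)) (trans (cong (d *_) (⁻¹-inverseʳ x x≢0)) (*-identityʳ d))

  -- The product form of the bound also makes sense at `x` equal to 0, where the reciprocal is
  -- infinite and lies above everything.
  d≤⁺1/⁺x : ∀ {d x} → 0# ≤ x → d * x ≤ 1# → [ d ] ≤⁺ 1/⁺ x
  d≤⁺1/⁺x {d} {x} 0≤x dx≤1 with x ≟ 0#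
  ... | yes _  = _ ≤⊤⁺
  ... | no x≢0 = [ subst₂ _≤_ (*⁻¹-cancel x≢0) (*-identityˡ (x ⁻¹))
                          (*-monoˡ-≤ (⁻¹-nonNegative 0≤x x≢0) dx≤1) ]

  1/⁺x≤⁺d : ∀ {d x} → 0# ≤ x → 1# ≤ d * x → 1/⁺ x ≤⁺ [ d ]
  1/⁺x≤⁺d {d} {x} 0≤x 1≤dx with x ≟ 0#
  -- A zero probability would give `1# ≤ 0#`.
  ... | yes refl = 1≰0 (subst (1# ≤_) (zeroʳ d) 1≤dx)
  ... | no x≢0   = [ subst₂ _≤_ (*-identityˡ (x ⁻¹)) (*⁻¹-cancel x≢0)
                            (*-monoˡ-≤ (⁻¹-nonNegative 0≤x x≢0) 1≤dx) ]

  sum-replicate : ∀ {b} {B : Set b} w (xs : List B) → sum (map (λ _ → w) xs) ≡ fromℕ (length xs) * w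
  sum-replicate w []       = sym (zeroˡ w)
  sum-replicate w (x ∷ xs) = trans (cong₂ _+_ (sym (*-identityˡ w)) (sum-replicate w xs))
                                   (sym (distribʳ w 1# (fromℕ (length xs))))

  -- Averaging: the witness is a minimiser of `g`, found by comparing the head with the minimiser of
  -- the tail.
  length*min≤sum : ∀ {b} {B : Set b} (g : B → Carrier) xs → length xs ≢ 0 →
                   ∃ λ x → x ∈ xs × fromℕ (length xs) * g x ≤ sum (map g xs)
  length*min≤sum g [] 0≢0 = contradiction refl 0≢0
  length*min≤sum g (x ∷ []) _ = x , here refl , ≤-reflexive
    (trans (distribʳ (g x) 1# 0#) (cong₂ _+_ (*-identityˡ (g x)) (zeroˡ (g x))))
  length*min≤sum g (x ∷ xs@(_ ∷ _)) _ with length*min≤sum g xs (λ ())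
  ... | z , z∈xs , Lz≤ with ≤-total (g x) (g z)
  ... | inj₁ gx≤gz = x , here refl , subst (_≤ _)
    (sym (trans (distribʳ (g x) 1# L) (cong (_+ L * g x) (*-identityˡ (g x)))))
    (+-mono-≤ ≤-refl (≤-trans (*-monoʳ-≤ (0≤fromℕ (length xs)) gx≤gz) Lz≤))
    where L = fromℕ (length xs)
  ... | inj₂ gz≤gx = z , there z∈xs , subst (_≤ _)
    (sym (trans (distribʳ (g z) 1# L) (cong (_+ L * g z) (*-identityˡ (g z)))))
    (+-mono-≤ gz≤gx Lz≤)
    where L = fromℕ (length xs)

  -- Probabilities of events under weighted lists.

  module _ {s} {S : Set s} where

    -- For the event `Correct x y` this unfolds to `successProbability`. The total weight is left
    -- arbitrary so that induction on the entries is possible.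
    mass : ∀ {p} {P : Pred S p} → Decidable P → List (Carrier × S) → Carrier
    mass P? es = sum (map proj₁ (filter (P? ∘ proj₂) es))

    NonNegative : List (Carrier × S) → Set _
    NonNegative = All (λ (w , _) → 0# ≤ w)

    mass-nonNegative : ∀ {p} {P : Pred S p} (P? : Decidable P) {es} → NonNegative es → 0# ≤ mass P? es
    mass-nonNegative P? [] = ≤-refl
    mass-nonNegative P? {(w , s) ∷ es} (0≤w ∷ 0≤es) with P? s
    ... | yes _ = ≤-trans (mass-nonNegative P? 0≤es) (y≤x+y 0≤w)
    ... | no _  = mass-nonNegative P? 0≤es

    weight≤mass : ∀ {p} {P : Pred S p} (P? : Decidable P) {es w s} → NonNegative es →
                  (w , s) ∈ es → P s → w ≤ mass P? es
    weight≤mass P? {(w , s) ∷ es} (0≤w ∷ 0≤es) (here refl) Ps with P? s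
    ... | yes _ = x≤x+y (mass-nonNegative P? 0≤es)
    ... | no ¬p = contradiction Ps ¬p
    weight≤mass P? {(w , s) ∷ es} (0≤w ∷ 0≤es) (there ∈es) Ps with P? s
    ... | yes _ = ≤-trans (weight≤mass P? 0≤es ∈es Ps) (y≤x+y 0≤w)
    ... | no _  = weight≤mass P? 0≤es ∈es Ps

    -- Disjointness is encoded by labels: an outcome `s` in event `C i` has `g s ≡ h i`, so events
    -- with distinct labels share no outcome.
    module _ {i j p} {I : Set i} {J : Set j} {C : I → Pred S p} (C? : ∀ i → Decidable (C i))
      (g : S → J) (h : I → J) (C⇒≡ : ∀ i {s} → C i s → g s ≡ h i) where

      private
        total : List (Carrier × S) → List I → Carrier
        total es is = sum (map (λ i → mass (C? i) es) is)

        total-[] : ∀ is → total [] is ≡ 0#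
        total-[] []       = refl
        total-[] (_ ∷ is) = trans (+-identityˡ _) (total-[] is)

        total-∷-∉ : ∀ {w s es} is → g s ∉ map h is → total ((w , s) ∷ es) is ≡ total es is
        total-∷-∉ [] _ = refl
        total-∷-∉ {s = s} (i ∷ is) gs∉ with C? i s
        ... | yes c = contradiction (here (C⇒≡ i c)) gs∉
        ... | no _  = cong (_ +_) (total-∷-∉ is (gs∉ ∘ there))

        total-∷ : ∀ {w s es} is → 0# ≤ w → Unique (map h is) →
                  total ((w , s) ∷ es) is ≤ w + total es is
        total-∷ {w} [] 0≤w _ = subst (0# ≤_) (sym (+-identityʳ w)) 0≤w
        total-∷ {w} {s} {es} (i ∷ is) 0≤w (hi∉ ∷ u) with C? i s
        -- The entry counts for event `i`; the later labels all differ from its own, so it counts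
        -- for no other event.
        ... | yes c = ≤-reflexive (trans (+-assoc w _ _)
          (cong (λ t → w + (_ + t)) (total-∷-∉ is (subst (_∉ map h is) (sym (C⇒≡ i c)) (All.All¬⇒¬Any hi∉)))))
        ... | no _  = ≤-trans (+-mono-≤ ≤-refl (total-∷ is 0≤w u)) (≤-reflexive
          (trans (sym (+-assoc m w _)) (trans (cong (_+ total es is) (+-comm m w)) (+-assoc w m _))))
          where m = mass (C? i) es

      sum-disjoint-masses : ∀ {is es} → NonNegative es → Unique (map h is) →
                            sum (map (λ i → mass (C? i) es) is) ≤ sum (map proj₁ es)
      sum-disjoint-masses {is} []           u = ≤-reflexive (total-[] is)
      sum-disjoint-masses {is} (0≤w ∷ 0≤es) u =
        ≤-trans (total-∷ is 0≤w u) (+-mono-≤ ≤-refl (sum-disjoint-masses 0≤es u))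

-- Bounds on the cost

map-proj₁-toList : ∀ {a p} {A : Set a} {P : A → Set p} {xs} (pxs : All P xs) →
                   map proj₁ (All.toList pxs) ≡ xs
map-proj₁-toList []         = refl
map-proj₁-toList (px ∷ pxs) = cong (_ ∷_) (map-proj₁-toList pxs)

module _ {n} (f : PartialBoolFn n) where

  -- Each sensitive bit carries the proof that places the flipped input in a preimage, where
  -- strategies are defined.
  sensitiveNeighbours : ∀ x b → List (∃ λ i → f (flipBit x i) ≡ just (not b))
  sensitiveNeighbours x b = All.toList (All.all-filter (λ i → f (flipBit x i) ≟ᵐ just (not b)) (allFin n))

  directions-unique : ∀ x b → Unique (map proj₁ (sensitiveNeighbours x b))
  directions-unique x b = subst Unique
    (sym (map-proj₁-toList (All.all-filter (λ i → f (flipBit x i) ≟ᵐ just (not b)) (allFin n))))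
    (filter⁺ _ (allFin⁺ n))

  length-sensitiveNeighbours : ∀ x b → length (sensitiveNeighbours x b) ≡ length (sensitiveBits f x b)
  length-sensitiveNeighbours x b = trans (sym (length-map proj₁ (sensitiveNeighbours x b)))
    (cong length (map-proj₁-toList (All.all-filter (λ i → f (flipBit x i) ≟ᵐ just (not b)) (allFin n))))

someBit : ∀ {n} (f : PartialBoolFn n) → sensitivity f ≢ 0 → Fin n
-- Without coordinates the list of sensitive bits is empty, so the sensitivity would be 0.
someBit {zero}  f s≢0 with _ , _ , _ , 0≡s ← mostSensitiveInput f s≢0 = contradiction (sym 0≡s) s≢0
someBit {suc n} f s≢0 = zero

module _ {c ℓ} (K : OrderedField c ℓ) where
  open OrderedField K
  open OrderedFieldProperties K
  open CertificateGame K
  open AddSupremum _≤_ using ([_])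
  private module Max = Data.List.Extrema totalOrder⁺

  module _ {n} (f : PartialBoolFn n) (s≢0 : sensitivity f ≢ 0) where

    private
      d : Carrier
      d = fromℕ (sensitivity f)

      0≤d : 0# ≤ d
      0≤d = 0≤fromℕ (sensitivity f)

      d≢0 : d ≢ 0#
      d≢0 = fromℕ≢0 s≢0

      i₀ : Fin n
      i₀ = someBit f s≢0

    -- Common form of the lower bound for both values of the most sensitive input. `ys` lists its
    -- neighbours, `g` is the answer given at that input and `h` the differing coordinate. The
    -- winning events are disjoint, so the least likely one has probability at most `1/s(f)`.
    cost≥ : ∀ (p : Distribution (Strategy f)) {I : Set} (ys : List I)
            (left : I → Preimage f false) (right : I → Preimage f true) →
            (∀ y → hamming (proj₁ (left y)) (proj₁ (right y)) ≡ 1) →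
            (g : Strategy f → Fin n) (h : I → Fin n) →
            (∀ y {S} → Correct {f = f} (left y) (right y) S → g S ≡ h y) →
            Unique (map h ys) → length ys ≡ sensitivity f → [ d ] ≤⁺ cost p
    cost≥ p {I} ys left right adjacent g h correct⇒≡ unique length≡ =
      conclude (length*min≤sum success ys (subst (_≢ 0) (sym length≡) s≢0))
      where
      open Distribution p
      success : I → Carrier
      success y = successProbability p (left y) (right y)
      sum≤1 : sum (map success ys) ≤ 1#
      sum≤1 = subst (sum (map success ys) ≤_) total
        (sum-disjoint-masses (λ y → correct? (left y) (right y)) g h correct⇒≡ nonNegative unique)
      conclude : (∃ λ y → y ∈ ys × fromℕ (length ys) * success y ≤ sum (map success ys)) →
                 [ d ] ≤⁺ cost p
      -- The pair belonging to `y` is one of those over which the cost is maximised.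
      conclude (y , _ , dy≤) = Max.v≤max⁺ [ 0# ] _ (inj₂ (lose
        (∈-map⁺ (λ (x , y) → 1/⁺ (successProbability p x y)) (∈-sensitivePairs f (adjacent y)))
        (d≤⁺1/⁺x (mass-nonNegative (correct? (left y) (right y)) nonNegative)
          (≤-trans (subst (λ m → fromℕ m * success y ≤ sum (map success ys)) length≡ dy≤) sum≤1))))

    sensitivity≤cost : ∀ p → [ d ] ≤⁺ cost p
    sensitivity≤cost p with mostSensitiveInput f s≢0
    ... | x , false , fx≡ , s≡ = cost≥ p (sensitiveNeighbours f x false)
      (λ _ → x , fx≡) (λ (i , fy≡) → flipBit x i , fy≡)
      (λ (i , _) → hamming-flipBit x i)
      -- The answer at `x` is the same for every neighbour, so it can be right for one direction
      -- only.
      (λ (A , _) → A (x , fx≡)) proj₁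
      (λ (i , _) (_ , xᵢ≢yᵢ) → flipBit-differs x i _ xᵢ≢yᵢ)
      (directions-unique f x false)
      (trans (length-sensitiveNeighbours f x false) s≡)
    ... | x , true , fx≡ , s≡ = cost≥ p (sensitiveNeighbours f x true)
      (λ (i , fy≡) → flipBit x i , fy≡) (λ _ → x , fx≡)
      (λ (i , _) → subst (λ z → hamming (flipBit x i) z ≡ 1) (flipBit-involutive x i)
                         (hamming-flipBit (flipBit x i) i))
      (λ (_ , B) → B (x , fx≡)) proj₁
      -- `Correct` compares the bits at the answer of `A`; agreement of the players transfers this
      -- to the answer of `B`, given at `x`.
      (λ { (i , _) {A , B} (A≡B , xᵢ≢yᵢ) → flipBit-differs x i _
             (subst (λ j → lookup x j ≢ lookup (flipBit x i) j) A≡B (xᵢ≢yᵢ ∘ sym)) })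
      (directions-unique f x true)
      (trans (length-sensitiveNeighbours f x true) s≡)

    -- The weights sum to 1 because there are exactly `s(f)` classes. Several entries may carry the
    -- same strategy.
    optimal : Distribution (Strategy f)
    optimal = record
      { entries     = map (λ M → d ⁻¹ , matchingStrategy f i₀ M) (colourClasses f)
      ; nonNegative = All.map⁺ (All.universal (λ _ → ⁻¹-nonNegative 0≤d d≢0) (colourClasses f))
      ; total       = trans (cong sum (sym (map-∘ (colourClasses f))))
          (trans (sum-replicate (d ⁻¹) (colourClasses f))
          (trans (cong (λ m → fromℕ m * d ⁻¹) (length-colourClasses f)) (⁻¹-inverseʳ d d≢0)))
      }

    -- The class containing the edge from `x` to `y` yields a winning strategy, and its entry alone
    -- has weight `d ⁻¹`.
    1≤d*success : ∀ x y → hamming (proj₁ x) (proj₁ y) ≡ 1 → 1# ≤ d * successProbability optimal x y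
    1≤d*success (x , fx≡) (y , fy≡) h
      with i , refl ← hamming≡1⇒flipBit x y h
      with M , e∈M , M∈ , matching ← edge∈colourClass f fx≡ fy≡
      = subst (_≤ d * successProbability optimal (x , fx≡) (flipBit x i , fy≡))
          (⁻¹-inverseʳ d d≢0) (*-monoʳ-≤ 0≤d
          (weight≤mass (correct? (x , fx≡) (flipBit x i , fy≡)) (Distribution.nonNegative optimal)
            (∈-map⁺ (λ M → d ⁻¹ , matchingStrategy f i₀ M) M∈)
            (matchingStrategy-correct f i₀ matching e∈M fx≡ fy≡)))

    cost≤sensitivity : cost optimal ≤⁺ [ d ]
    -- The maximum starts from the base value `[ 0# ]`, which must lie below `d` as well.
    cost≤sensitivity = Max.max≤v⁺ {xs = map 1/success (sensitivePairs f)} [ 0≤d ]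
      (All.map⁺ (All.tabulate bound))
      where
      1/success : Preimage f false × Preimage f true → Carrier ⁺
      1/success (x , y) = 1/⁺ (successProbability optimal x y)
      bound : ∀ {xy} → xy ∈ sensitivePairs f → 1/success xy ≤⁺ [ d ]
      bound {x , y} xy∈ = 1/⁺x≤⁺d (mass-nonNegative (correct? x y) (Distribution.nonNegative optimal))
        (1≤d*success x y (proj₂ (∈-filter⁻ (λ ((x , _) , (y , _)) → hamming x y ℕ.≟ 1)
          {xs = cartesianProduct (preimages f false) (preimages f true)} xy∈)))

theorem8p4 : ∀ {c ℓ} (K : OrderedField c ℓ) →
    let open OrderedField K
        open CertificateGame K
    in ∃₂ λ (c₁ c₂ : Carrier) → 0# < c₁ × 0# < c₂ ×
       (∀ (n : ℕ) (f : PartialBoolFn n) → sensitivity f ≢ 0 →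
          ∃ λ (v : Carrier ⁺) → IsCGpub₁ f v ×
            [ c₁ * fromℕ (sensitivity f) ] ≤⁺ v ×
            v ≤⁺ [ c₂ * fromℕ (sensitivity f) ])
theorem8p4 K =
  1# , 1# , (0≤1 , 0#≢1#) , (0≤1 , 0#≢1#) , λ n f s≢0 →
    [ fromℕ (sensitivity f) ] ,
    ((optimal K f s≢0 ,
      TotalOrder.antisym totalOrder⁺ (cost≤sensitivity K f s≢0)
        (sensitivity≤cost K f s≢0 (optimal K f s≢0))) ,
     sensitivity≤cost K f s≢0) ,
    [ ≤-reflexive (*-identityˡ _) ] , [ ≤-reflexive (sym (*-identityˡ _)) ]
  where
  open OrderedField K
  open OrderedFieldProperties K
  open AddSupremum _≤_ using ([_])
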